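{- Up to isomorphism, the only $1$-dimensional obstruction to shellability is the simplicial complex on four distinct vertices $a,b,c,d$ whose facets are $\{a,b\}$ and $\{c,d\}$.
   Context: All simplicial complexes are finite (abstract) and contain the empty face; if $K$ is a simplicial complex on vertex set $V$, then $\{v\}\in K$ for every $v\in V$. Facets are the inclusion-maximal faces; $\dim F=|F|-1$. A complex is pure if all its facets have the same dimension. For $U\subseteq V$, the induced subcomplex $K(U)$ is $\{F\in K: F\subseteq U\}$; it is proper if $U\subsetneq V$. Shellability means (not necessarily pure) shellability: $K$ is shellable if its facets can be ordered $F_1,\dots,F_t$ so that for each $k=2,\dots,t$ the complex $\left(\bigcup_{i=1}^{k-1}\bar F_i\right)\cap \bar F_k$ is pure of dimension $\dim F_k-1$, where $\bar F$ denotes the simplex consisting of all subsets of $F$. An obstruction to shellability is a nonshellable simplicial complex all of whose proper induced subcomplexes are shellable. -}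

module Defs where

open import Data.Fin.Base using (Fin; toℕ; _<_)
open import Data.Fin.Patterns using (0F; 1F; 2F; 3F)
open import Data.Fin.Subset using (Subset; _∈_; _⊆_; _⊂_; ⊥; ⊤; ⁅_⁆; _∪_; ∣_∣)
open import Data.Fin.Subset.Properties
  using (_⊆?_; ⊆-trans; ⊆-min; ⊆-max; p⊆p∪q; q⊆p∪q; x∈⁅y⁆⇒x≡y)
open import Data.Integer.Base using (ℤ; +_; _-_; _≤_; 1ℤ)
import Data.Nat.Base as ℕ
open import Data.Nat.Base using (ℕ)
open import Data.Product.Base using (Σ-syntax; ∃; _×_; _,_; proj₁)
open import Data.Sum.Base using (_⊎_; inj₁; inj₂)
import Data.Sum.Base as Sum
open import Function.Bundles using (_⇔_; _↔_; module Inverse)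
open import Function.Definitions using (Injective)
open import Level using (0ℓ)
open import Relation.Binary.PropositionalEquality.Core using (_≡_; refl)
open import Relation.Nullary.Decidable.Core using (_×-dec_; _⊎-dec_)
open import Relation.Nullary.Negation.Core using (¬_)
open import Relation.Unary using (Pred; Decidable; _∩_; ⋃)

-- The vertex set is an arbitrary subset of Fin n, not all of Fin n, so that an
-- induced subcomplex is again a complex over the same Fin n.
record SimplicialComplex (n : ℕ) : Set₁ where
  field
    vertices   : Subset n
    Face       : Pred (Subset n) 0ℓ
    face?      : Decidable Face
    face⊆      : ∀ {F} → Face F → F ⊆ vertices
    ∅-face     : Face ⊥
    vertexFace : ∀ {v} → v ∈ vertices → Face ⁅ v ⁆
    downClosed : ∀ {F G} → G ⊆ F → Face F → Face G

open SimplicialComplex public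

dim : ∀ {n} → Subset n → ℤ
dim F = + ∣ F ∣ - 1ℤ

Facet : ∀ {n} → Pred (Subset n) 0ℓ → Pred (Subset n) 0ℓ
Facet Δ F = Δ F × (∀ {G} → Δ G → F ⊆ G → F ≡ G)

PureOfDimension : ∀ {n} → Pred (Subset n) 0ℓ → ℤ → Set
PureOfDimension Δ d = ∀ {F} → Facet Δ F → dim F ≡ d

HasDimension : ∀ {n} → SimplicialComplex n → ℤ → Set
HasDimension K d = (∃ λ F → Face K F × dim F ≡ d) × (∀ {F} → Face K F → dim F ≤ d)

simplex : ∀ {n} → Subset n → Pred (Subset n) 0ℓ
simplex F G = G ⊆ F

earlierSimplices : ∀ {n t} → (Fin t → Subset n) → Fin t → Pred (Subset n) 0ℓ
earlierSimplices {t = t} F k = ⋃ (Σ[ i ∈ Fin t ] i < k) (λ (i , _) → simplex (F i))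

record IsShelling {n t} (K : SimplicialComplex n) (F : Fin t → Subset n) : Set where
  field
    distinct : Injective _≡_ _≡_ F
    facets   : ∀ G → Facet (Face K) G ⇔ (∃ λ i → F i ≡ G)
    -- Indices start at 0, so the first facet is the one that is exempt.
    shelling : ∀ k → 0 ℕ.< toℕ k →
               PureOfDimension (earlierSimplices F k ∩ simplex (F k)) (dim (F k) - 1ℤ)

Shellable : ∀ {n} → SimplicialComplex n → Set
Shellable {n} K = ∃ λ t → Σ[ F ∈ (Fin t → Subset n) ] IsShelling K F

induced : ∀ {n} (K : SimplicialComplex n) (U : Subset n) → U ⊆ vertices K → SimplicialComplex n
induced K U U⊆V = record
  { vertices   = U
  ; Face       = λ F → Face K F × F ⊆ U
  ; face?      = λ F → face? K F ×-dec (F ⊆? U)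
  ; face⊆      = λ (_ , F⊆U) → F⊆U
  ; ∅-face     = ∅-face K , ⊆-min U
  ; vertexFace = λ v∈U → vertexFace K (U⊆V v∈U) , ⁅⁆⊆ v∈U
  ; downClosed = λ G⊆F (F∈K , F⊆U) → downClosed K G⊆F F∈K , ⊆-trans G⊆F F⊆U
  }
  where
  ⁅⁆⊆ : ∀ {v} → v ∈ U → ⁅ v ⁆ ⊆ U
  ⁅⁆⊆ {v} v∈U x∈⁅v⁆ with refl ← x∈⁅y⁆⇒x≡y v x∈⁅v⁆ = v∈U

IsObstruction : ∀ {n} → SimplicialComplex n → Set
IsObstruction K =
  ¬ Shellable K × (∀ U → (U⊂V : U ⊂ vertices K) → Shellable (induced K U (proj₁ U⊂V)))

Vertex : ∀ {n} → SimplicialComplex n → Set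
Vertex K = ∃ λ v → v ∈ vertices K

module _ {m n} (K : SimplicialComplex m) (L : SimplicialComplex n) where

  IsImage : (Vertex K → Vertex L) → Subset m → Subset n → Set
  IsImage f F G = ∀ y → y ∈ G ⇔ (∃ λ (x : Vertex K) → proj₁ x ∈ F × proj₁ (f x) ≡ y)

  record _≅_ : Set where
    field
      bijection : Vertex K ↔ Vertex L
      -- F ⊆ vertices K is needed: IsImage ignores elements of F outside the vertex set.
      faces     : ∀ {F G} → F ⊆ vertices K → IsImage (Inverse.to bijection) F G →
                  Face K F ⇔ Face L G

twoDisjointEdges : SimplicialComplex 4
twoDisjointEdges = record
  { vertices   = ⊤
  ; Face       = λ F → F ⊆ ab ⊎ F ⊆ cd
  ; face?      = λ F → (F ⊆? ab) ⊎-dec (F ⊆? cd)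
  ; face⊆      = λ {F} _ → ⊆-max F
  ; ∅-face     = inj₁ (⊆-min ab)
  ; vertexFace = λ {v} _ → singleton v
  ; downClosed = λ G⊆F → Sum.map (⊆-trans G⊆F) (⊆-trans G⊆F)
  }
  where
  ab cd : Subset 4
  ab = ⁅ 0F ⁆ ∪ ⁅ 1F ⁆
  cd = ⁅ 2F ⁆ ∪ ⁅ 3F ⁆

  singleton : ∀ v → ⁅ v ⁆ ⊆ ab ⊎ ⁅ v ⁆ ⊆ cd
  singleton 0F = inj₁ (p⊆p∪q ⁅ 1F ⁆)
  singleton 1F = inj₁ (q⊆p∪q ⁅ 0F ⁆ ⁅ 1F ⁆)
  singleton 2F = inj₂ (p⊆p∪q ⁅ 3F ⁆)
  singleton 3F = inj₂ (q⊆p∪q ⁅ 2F ⁆ ⁅ 3F ⁆)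

{-# OPTIONS --safe #-}

-- Call two edges linked if some edge meets both. If any two edges of a graph are linked, then
-- listing the facets by their distance from a fixed edge e₀ (first e₀, then the edges meeting
-- e₀, then everything else) is a shelling: an edge disjoint from e₀ meets an edge that meets e₀
-- and comes earlier. So a nonshellable graph contains two unlinked edges E and F. The subcomplex
-- induced on E ∪ F then consists of just these two disjoint edges and is nonshellable, whence
-- an obstruction has no further vertices.

module Submission where

open import Defs
import Data.Bool.Properties as Bool
open import Data.Empty using (⊥-elim)
open import Data.Fin.Base using (Fin; zero; suc; _≤_; _<_; toℕ)
open import Data.Fin.Patterns using (0F; 1F; 2F; 3F)
import Data.Fin.Properties as Fin
open import Data.Fin.Subset
  using (Subset; inside; outside; _∈_; _∉_; _⊆_; _⊂_; ⊥; ⁅_⁆; _∪_; _∩_; ∣_∣; Nonempty)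
open import Data.Fin.Subset.Properties
open import Data.Integer.Base as ℤ using (1ℤ)
import Data.Integer.Properties as ℤ
open import Data.List.Base using (List; []; _∷_; length; lookup; filter; cartesianProductWith)
import Data.List.Membership.Propositional as List
open import Data.List.Membership.Propositional.Properties
  using (∈-lookup; ∈-filter⁺; ∈-filter⁻; ∈-cartesianProductWith⁺)
open import Data.List.Relation.Binary.Permutation.Propositional using (↭-sym; ↭⇒↭ₛ)
open import Data.List.Relation.Binary.Permutation.Propositional.Properties using (∈-resp-↭)
import Data.List.Relation.Binary.Permutation.Setoid.Properties as Permutation
import Data.List.Relation.Unary.All as All
open import Data.List.Relation.Unary.AllPairs using ([]; _∷_)
open import Data.List.Relation.Unary.Any using (here; there; index)
open import Data.List.Relation.Unary.Any.Properties using (lookup-index)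
open import Data.List.Relation.Unary.Sorted.TotalOrder.Properties using (lookup-mono-≤)
open import Data.List.Relation.Unary.Unique.Propositional using (Unique)
import Data.List.Relation.Unary.Unique.Propositional.Properties as Unique
import Data.List.Sort as Sort
open import Data.Nat.Base as ℕ using (ℕ; zero; suc; z≤n; s≤s)
import Data.Nat.Properties as ℕ
open import Data.Product.Base using (∃; ∃₂; _×_; _,_; proj₁; proj₂)
open import Data.Sum.Base as Sum using (_⊎_; inj₁; inj₂)
open import Data.Vec.Base using ([]; _∷_; here; there)
import Data.Vec.Properties as Vec
open import Data.Vec.Properties.WithK using ([]=-irrelevant)
open import Function.Base using (_∘_; id)
open import Function.Bundles using (_⇔_; _↔_; mk⇔; mk⤖; module Equivalence; module Inverse)
open import Function.Properties.Bijection using (⤖⇒↔)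
open import Function.Properties.Inverse using (↔-sym)
open import Relation.Binary.Bundles using (DecTotalOrder)
open import Relation.Binary.Definitions using (tri<; tri≈; tri>)
import Relation.Binary.Construct.On as On
open import Relation.Binary.PropositionalEquality
  using (_≡_; _≢_; refl; sym; trans; cong; subst; setoid)
open import Relation.Nullary.Decidable
  using (Dec; yes; no; ¬?; _×-dec_; map′; decidable-stable)
open import Relation.Nullary.Negation using (¬_; contradiction)
open import Relation.Unary using (Decidable)

private variable
  m n : ℕ

-- Finite sets

_≟_ : (p q : Subset n) → Dec (p ≡ q)
_≟_ = Vec.≡-dec Bool._≟_

p⊈q⇒∃∈∉ : {p q : Subset n} → ¬ p ⊆ q → ∃ λ x → x ∈ p × x ∉ q
p⊈q⇒∃∈∉ {p = p} {q} p⊈q with Fin.any? (λ x → (x ∈? p) ×-dec ¬? (x ∈? q))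
... | yes w = w
... | no ¬w = contradiction
  (λ {x} x∈p → decidable-stable (x ∈? q) λ x∉q → ¬w (x , x∈p , x∉q)) p⊈q

p⊆q∧p≢q⇒p⊂q : {p q : Subset n} → p ⊆ q → p ≢ q → p ⊂ q
p⊆q∧p≢q⇒p⊂q p⊆q p≢q = p⊆q , p⊈q⇒∃∈∉ λ q⊆p → p≢q (⊆-antisym p⊆q q⊆p)

p⊆q∧∣q∣≤∣p∣⇒p≡q : {p q : Subset n} → p ⊆ q → ∣ q ∣ ℕ.≤ ∣ p ∣ → p ≡ q
p⊆q∧∣q∣≤∣p∣⇒p≡q {p = p} {q} p⊆q ∣q∣≤∣p∣ = decidable-stable (p ≟ q) λ p≢q →
  ℕ.<⇒≱ (p⊂q⇒∣p∣<∣q∣ (p⊆q∧p≢q⇒p⊂q p⊆q p≢q)) ∣q∣≤∣p∣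

Nonempty⇒0<∣p∣ : {p : Subset n} → Nonempty p → 0 ℕ.< ∣ p ∣
Nonempty⇒0<∣p∣ (_ , x∈p) = ℕ.≤-<-trans z≤n (x∈p⇒∣p-x∣<∣p∣ x∈p)

0<∣p∣⇒Nonempty : (p : Subset n) → 0 ℕ.< ∣ p ∣ → Nonempty p
0<∣p∣⇒Nonempty {n} p 0<∣p∣ = decidable-stable (nonempty? p) λ empty →
  ℕ.<⇒≢ 0<∣p∣ (sym (trans (cong ∣_∣ (Empty-unique empty)) (∣⊥∣≡0 n)))

x∈p∧y∈p∧x≢y⇒2≤∣p∣ : ∀ {x y} {p : Subset n} → x ∈ p → y ∈ p → x ≢ y → 2 ℕ.≤ ∣ p ∣
x∈p∧y∈p∧x≢y⇒2≤∣p∣ x∈p y∈p x≢y = ℕ.≤-<-trans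
  (Nonempty⇒0<∣p∣ (_ , x∈p∧x≢y⇒x∈p-y y∈p (x≢y ∘ sym))) (x∈p⇒∣p-x∣<∣p∣ x∈p)

⁅x⁆⊆p : ∀ {x} {p : Subset n} → x ∈ p → ⁅ x ⁆ ⊆ p
⁅x⁆⊆p {x = x} x∈p y∈⁅x⁆ with refl ← x∈⁅y⁆⇒x≡y x y∈⁅x⁆ = x∈p

∪⊆ : {p q r : Subset n} → p ⊆ r → q ⊆ r → p ∪ q ⊆ r
∪⊆ {p = p} {q} p⊆r q⊆r x∈p∪q with x∈p∪q⁻ p q x∈p∪q
... | inj₁ x∈p = p⊆r x∈p
... | inj₂ x∈q = q⊆r x∈q

∣p∣≡0⇒p≡⊥ : {p : Subset n} → ∣ p ∣ ≡ 0 → p ≡ ⊥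
∣p∣≡0⇒p≡⊥ ∣p∣≡0 = Empty-unique λ ne → ℕ.<⇒≢ (Nonempty⇒0<∣p∣ ne) (sym ∣p∣≡0)

∣p∣≡1⇒p≡⁅x⁆ : (p : Subset n) → ∣ p ∣ ≡ 1 → ∃ λ x → p ≡ ⁅ x ⁆
∣p∣≡1⇒p≡⁅x⁆ (inside ∷ p) eq = zero , cong (inside ∷_) (∣p∣≡0⇒p≡⊥ (ℕ.suc-injective eq))
∣p∣≡1⇒p≡⁅x⁆ (outside ∷ p) eq with x , refl ← ∣p∣≡1⇒p≡⁅x⁆ p eq = suc x , refl

∣p∣≡2⇒p≡⁅x⁆∪⁅y⁆ : (p : Subset n) → ∣ p ∣ ≡ 2 → ∃₂ λ x y → x ≢ y × p ≡ ⁅ x ⁆ ∪ ⁅ y ⁆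
∣p∣≡2⇒p≡⁅x⁆∪⁅y⁆ (inside ∷ p) eq with y , refl ← ∣p∣≡1⇒p≡⁅x⁆ p (ℕ.suc-injective eq) =
  zero , suc y , (λ ()) , cong (inside ∷_) (sym (∪-identityˡ _))
∣p∣≡2⇒p≡⁅x⁆∪⁅y⁆ (outside ∷ p) eq with x , y , x≢y , refl ← ∣p∣≡2⇒p≡⁅x⁆∪⁅y⁆ p eq =
  suc x , suc y , x≢y ∘ Fin.suc-injective , refl

-- Listing all subsets without repetition

allSubsets : ∀ n → List (Subset n)
allSubsets zero    = [] ∷ []
allSubsets (suc n) = cartesianProductWith _∷_ (inside ∷ outside ∷ []) (allSubsets n)

∈-allSubsets : (p : Subset n) → p List.∈ allSubsets n
∈-allSubsets [] = here refl
∈-allSubsets (inside ∷ p) =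
  ∈-cartesianProductWith⁺ _∷_ {xs = inside ∷ outside ∷ []} (here refl) (∈-allSubsets p)
∈-allSubsets (outside ∷ p) =
  ∈-cartesianProductWith⁺ _∷_ {xs = inside ∷ outside ∷ []} (there (here refl)) (∈-allSubsets p)

allSubsets-unique : ∀ n → Unique (allSubsets n)
allSubsets-unique zero    = All.[] ∷ []
allSubsets-unique (suc n) = Unique.cartesianProductWith⁺ _∷_ Vec.∷-injective
  (((λ ()) All.∷ All.[]) ∷ All.[] ∷ []) (allSubsets-unique n)

lookup-injective : {A : Set} {xs : List A} → Unique xs →
                   ∀ {i j} → lookup xs i ≡ lookup xs j → i ≡ j
lookup-injective (_    ∷ _)   {zero}  {zero}  _  = refl
lookup-injective (x∉xs ∷ _)   {zero}  {suc j} eq = contradiction eq (All.lookup x∉xs (∈-lookup j))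
lookup-injective (x∉xs ∷ _)   {suc i} {zero}  eq =
  contradiction (sym eq) (All.lookup x∉xs (∈-lookup i))
lookup-injective (_    ∷ xs!) {suc i} {suc j} eq = cong suc (lookup-injective xs! eq)

-- Dimension and facets

dim-suc : (F G : Subset n) → ∣ F ∣ ≡ suc ∣ G ∣ → dim G ≡ dim F ℤ.- 1ℤ
dim-suc F G eq rewrite eq = refl

dim≤1⇒∣F∣≤2 : (F : Subset n) → dim F ℤ.≤ 1ℤ → ∣ F ∣ ℕ.≤ 2
dim≤1⇒∣F∣≤2 F dimF≤1 with ∣ F ∣
... | 0 = z≤n
... | 1 = s≤s z≤n
... | 2 = ℕ.≤-refl
... | suc (suc (suc _)) with ℤ.+≤+ (s≤s ()) ← dimF≤1

∣F∣≤2⇒dim≤1 : (F : Subset n) → ∣ F ∣ ℕ.≤ 2 → dim F ℤ.≤ 1ℤ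
∣F∣≤2⇒dim≤1 F ∣F∣≤2 = ℤ.+-monoˡ-≤ (ℤ.- 1ℤ) (ℤ.+≤+ ∣F∣≤2)

-- A nonmaximal face is exposed by a strictly larger one, which a finite search over all subsets
-- finds or rules out.
facet? : (K : SimplicialComplex n) → Decidable (Facet (Face K))
facet? K F = face? K F ×-dec map′ none⇒maximal maximal⇒none (¬? (anySubset? larger?))
  where
  Larger : Subset _ → Set
  Larger G = Face K G × F ⊆ G × F ≢ G

  larger? : Decidable Larger
  larger? G = face? K G ×-dec (F ⊆? G) ×-dec ¬? (F ≟ G)

  none⇒maximal : ¬ ∃ Larger → ∀ {G} → Face K G → F ⊆ G → F ≡ G
  none⇒maximal none {G} G∈K F⊆G = decidable-stable (F ≟ G) λ F≢G → none (G , G∈K , F⊆G , F≢G)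

  maximal⇒none : (∀ {G} → Face K G → F ⊆ G → F ≡ G) → ¬ ∃ Larger
  maximal⇒none maximal (_ , G∈K , F⊆G , F≢G) = F≢G (maximal G∈K F⊆G)

Edge : SimplicialComplex n → Subset n → Set
Edge K E = Face K E × ∣ E ∣ ≡ 2

-- Only an upper bound on the dimension, so that every induced subcomplex inherits it, even one
-- without edges.
Graph : SimplicialComplex n → Set
Graph K = ∀ {F} → Face K F → ∣ F ∣ ℕ.≤ 2

edge-facet : {K : SimplicialComplex n} → Graph K → ∀ {E} → Edge K E → Facet (Face K) E
edge-facet graph (E∈K , ∣E∣≡2) =
  E∈K , λ G∈K E⊆G → p⊆q∧∣q∣≤∣p∣⇒p≡q E⊆G (ℕ.≤-trans (graph G∈K) (ℕ.≤-reflexive (sym ∣E∣≡2)))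

-- Shelling graphs

earlier-index : ∀ {t} (k : Fin t) → 0 ℕ.< toℕ k → ∃ λ (i : Fin t) → i < k
earlier-index (suc k) _ = zero , ℕ.z<s

-- A maximal `G` is strictly smaller than `F k`, since distinct facets do not contain one another.
-- As `F k` has at most two elements, the only case to exclude is an empty `G` below an edge, and a
-- vertex shared with an earlier facet does so.
shelling-step : ∀ {t} {K : SimplicialComplex n} {F : Fin t → Subset n} →
  Graph K → (∀ i → Facet (Face K) (F i)) → (∀ {i j} → F i ≡ F j → i ≡ j) →
  ∀ k → ∣ F k ∣ ℕ.≤ 1 ⊎ (∃ λ i → i < k × Nonempty (F i ∩ F k)) →
  PureOfDimension (λ G → earlierSimplices F k G × G ⊆ F k) (dim (F k) ℤ.- 1ℤ)
shelling-step {F = F} graph facet inj k step {G} ((((i , i<k) , G⊆Fi) , G⊆Fk) , maximal) =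
  dim-suc (F k) G (ℕ.≤-antisym (lower step) (p⊂q⇒∣p∣<∣q∣ (p⊆q∧p≢q⇒p⊂q G⊆Fk G≢Fk)))
  where
  G≢Fk : G ≢ F k
  -- Otherwise `F k` would lie in the earlier `F i`, and maximality of `F k` would identify the two.
  G≢Fk refl = Fin.<⇒≢ i<k (inj (sym (proj₂ (facet k) (proj₁ (facet i)) G⊆Fi)))

  lower : ∣ F k ∣ ℕ.≤ 1 ⊎ (∃ λ i → i < k × Nonempty (F i ∩ F k)) → ∣ F k ∣ ℕ.≤ suc ∣ G ∣
  lower (inj₁ ∣Fk∣≤1) = ℕ.≤-trans ∣Fk∣≤1 (s≤s z≤n)
  lower (inj₂ (j , j<k , x , x∈Fj∩Fk)) =
    ℕ.≤-trans (graph (proj₁ (facet k))) (s≤s (Nonempty⇒0<∣p∣ G-nonempty))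
    where
    G-nonempty : Nonempty G
    G-nonempty = decidable-stable (nonempty? G) λ empty →
      -- An empty `G` would sit below the common face `⁅ x ⁆`; maximality would make them equal and
      -- put `x` in `G`.
      empty (x , subst (x ∈_)
        (sym (maximal
          ( ((j , j<k) , ⁅x⁆⊆p (p∩q⊆p (F j) (F k) x∈Fj∩Fk))
          , ⁅x⁆⊆p (p∩q⊆q (F j) (F k) x∈Fj∩Fk))
          (λ y∈G → ⊥-elim (empty (_ , y∈G)))))
        (x∈⁅x⁆ x))

module _ (K : SimplicialComplex n) (rank : Subset n → ℕ) where

  private
    byRank : DecTotalOrder _ _ _
    byRank = On.decTotalOrder ℕ.≤-decTotalOrder rank

    module S = Sort byRank

    order : List (Subset n)
    order = S.sort (filter (facet? K) (allSubsets n))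

    order-unique : Unique order
    order-unique = Permutation.Unique-resp-↭ (setoid (Subset n))
      (↭⇒↭ₛ (↭-sym (S.sort-↭ _))) (Unique.filter⁺ (facet? K) (allSubsets-unique n))

    ∈-order : ∀ {F} → Facet (Face K) F → F List.∈ order
    ∈-order F-facet = ∈-resp-↭ (↭-sym (S.sort-↭ _)) (∈-filter⁺ (facet? K) (∈-allSubsets _) F-facet)

    order-facet : ∀ i → Facet (Face K) (lookup order i)
    order-facet i =
      proj₂ (∈-filter⁻ (facet? K) {xs = allSubsets n} (∈-resp-↭ (S.sort-↭ _) (∈-lookup i)))

    rank-mono : ∀ {i j} → i ≤ j → rank (lookup order i) ℕ.≤ rank (lookup order j)
    rank-mono = lookup-mono-≤ (DecTotalOrder.totalOrder byRank) (S.sort-↗ _)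

  -- Three reasons for the step at `F` to succeed: `F` comes first, being the only facet of rank at
  -- most its own; it has at most one vertex; or a facet of strictly smaller rank meets it. None
  -- depends on how the sort breaks ties.
  Placed : Subset n → Set
  Placed F =
    (∀ G → Facet (Face K) G → rank G ℕ.≤ rank F → G ≡ F)
    ⊎ ∣ F ∣ ℕ.≤ 1
    ⊎ (∃ λ G → Facet (Face K) G × rank G ℕ.< rank F × Nonempty (G ∩ F))

  shellable-by-rank : Graph K → (∀ F → Facet (Face K) F → Placed F) → Shellable K
  shellable-by-rank graph cases = length order , lookup order , record
    { distinct = lookup-injective order-unique
    ; facets   = λ G → mk⇔
        (λ G-facet → index (∈-order G-facet) , sym (lookup-index (∈-order G-facet)))
        (λ { (i , refl) → order-facet i })
    ; shelling = λ k 0<k → shelling-step {K = K} graph order-facet (lookup-injective order-unique) k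
        (step k 0<k (cases (lookup order k) (order-facet k)))
    }
    where
    step : ∀ k → 0 ℕ.< toℕ k → Placed (lookup order k) →
           ∣ lookup order k ∣ ℕ.≤ 1 ⊎ (∃ λ i → i < k × Nonempty (lookup order i ∩ lookup order k))
    -- The facet at index 0 precedes `k`, so its rank is no larger and `first` identifies it with
    -- the facet at `k`, against distinctness.
    step k 0<k (inj₁ first) = contradiction
      (lookup-injective order-unique (first _ (order-facet i) (rank-mono (ℕ.<⇒≤ i<k))))
      (Fin.<⇒≢ i<k)
      where
      i   = proj₁ (earlier-index k 0<k)
      i<k = proj₂ (earlier-index k 0<k)
    step k 0<k (inj₂ (inj₁ ∣F∣≤1)) = inj₁ ∣F∣≤1
    step k 0<k (inj₂ (inj₂ (G , G-facet , rG<rF , meets))) = inj₂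
      ( i
      -- Sorting is only weakly monotone, so `i < k` comes by contraposition: `k ≤ i` would make the
      -- rank at `k` at most that of `G`.
      , ℕ.≰⇒> (λ k≤i → ℕ.<⇒≱ rG<rF (subst (λ H → _ ℕ.≤ rank H) (sym G≡) (rank-mono k≤i)))
      , subst (λ H → Nonempty (H ∩ _)) G≡ meets)
      where
      i = index (∈-order G-facet)
      G≡ = lookup-index (∈-order G-facet)

-- Linked edges and the ordering by distance

-- The linking edge may be `E` or `F` itself, so two edges that share a vertex are linked, and so is
-- an edge with itself.
Linked : SimplicialComplex n → Subset n → Subset n → Set
Linked K E F = ∃ λ G → Edge K G × Nonempty (E ∩ G) × Nonempty (G ∩ F)

edge? : (K : SimplicialComplex n) → Decidable (Edge K)
edge? K E = face? K E ×-dec (∣ E ∣ ℕ.≟ 2)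

linked? : (K : SimplicialComplex n) → ∀ E F → Dec (Linked K E F)
linked? K E F = anySubset? λ G → edge? K G ×-dec nonempty? (E ∩ G) ×-dec nonempty? (G ∩ F)

module _ {K : SimplicialComplex n} (graph : Graph K)
         (linked : ∀ {E F} → Edge K E → Edge K F → Linked K E F) where

  private
    edgeless-shellable : ¬ ∃ (Edge K) → Shellable K
    -- Every facet has at most one vertex here, so a constant rank suffices.
    edgeless-shellable edgeless = shellable-by-rank K (λ _ → 0) graph λ F (F∈K , _) →
      inj₂ (inj₁ (ℕ.≤-pred (ℕ.≤∧≢⇒< (graph F∈K) λ ∣F∣≡2 → edgeless (F , F∈K , ∣F∣≡2))))

    module _ {E₀ : Subset n} (E₀-edge : Edge K E₀) where

      -- Distance from `E₀` cut off at 2, the value shared by all remaining facets, isolated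
      -- vertices included. Equality takes precedence because `E₀` also meets itself.
      distance : Subset n → ℕ
      distance F with F ≟ E₀ | nonempty? (E₀ ∩ F)
      ... | yes _ | _     = 0
      ... | no  _ | yes _ = 1
      ... | no  _ | no  _ = 2

      distance≡0 : ∀ F → distance F ≡ 0 → F ≡ E₀
      distance≡0 F eq with F ≟ E₀ | nonempty? (E₀ ∩ F)
      distance≡0 F eq | yes F≡E₀ | _     = F≡E₀
      distance≡0 F () | no  _    | yes _
      distance≡0 F () | no  _    | no  _

      distance-E₀ : distance E₀ ≡ 0
      distance-E₀ with E₀ ≟ E₀
      ... | yes _     = refl
      ... | no  E₀≢E₀ = contradiction refl E₀≢E₀

      distance≤1 : ∀ {F} → Nonempty (E₀ ∩ F) → distance F ℕ.≤ 1
      distance≤1 {F} meets with F ≟ E₀ | nonempty? (E₀ ∩ F)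
      ... | yes _ | _         = z≤n
      ... | no  _ | yes _     = ℕ.≤-refl
      ... | no  _ | no  empty = contradiction meets empty

      shellable : Shellable K
      shellable = shellable-by-rank K distance graph cases
        where
        cases : ∀ F → Facet (Face K) F → Placed K distance F
        -- The first two tests also evaluate `distance F` in the goal: to 0 for `E₀`, to 1 for
        -- another facet meeting it, to 2 otherwise.
        cases F (F∈K , _) with F ≟ E₀ | nonempty? (E₀ ∩ F) | ∣ F ∣ ℕ.≟ 2
        ... | yes refl | _ | _ = inj₁ λ _ _ d≤0 → distance≡0 _ (ℕ.n≤0⇒n≡0 d≤0)
        ... | no _ | _ | no ∣F∣≢2 = inj₂ (inj₁ (ℕ.≤-pred (ℕ.≤∧≢⇒< (graph F∈K) ∣F∣≢2)))
        ... | no _ | yes meets | yes _ =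
          inj₂ (inj₂
            ( E₀ , edge-facet {K = K} graph E₀-edge
            , s≤s (ℕ.≤-reflexive distance-E₀) , meets))
        -- The linking edge meets `E₀`, so its distance is at most 1 while that of `F` is 2.
        ... | no _ | no _ | yes ∣F∣≡2
          with G , G-edge , E₀∩G , G∩F ← linked E₀-edge (F∈K , ∣F∣≡2) =
          inj₂ (inj₂ (G , edge-facet {K = K} graph G-edge , s≤s (distance≤1 E₀∩G) , G∩F))

  linked⇒shellable : Shellable K
  linked⇒shellable with anySubset? (edge? K)
  ... | yes (_ , E₀-edge) = shellable E₀-edge
  ... | no  edgeless      = edgeless-shellable edgeless

-- Pairs of disjoint edges

-- By downward closure the faces are then exactly the subsets of `A` and those of `B`: this is
-- `twoDisjointEdges` up to the names of the vertices.
record IsDisjointEdgePair (K : SimplicialComplex n) (A B : Subset n) : Set where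
  field
    edgeˡ    : Edge K A
    edgeʳ    : Edge K B
    disjoint : ∀ {x} → x ∈ A → x ∉ B
    covers   : ∀ {F} → Face K F → F ⊆ A ⊎ F ⊆ B

  nonemptyˡ : Nonempty A
  nonemptyˡ = 0<∣p∣⇒Nonempty A (ℕ.≤-trans (s≤s z≤n) (ℕ.≤-reflexive (sym (proj₂ edgeˡ))))

  graph : Graph K
  graph F∈K with covers F∈K
  ... | inj₁ F⊆A = ℕ.≤-trans (p⊆q⇒∣p∣≤∣q∣ F⊆A) (ℕ.≤-reflexive (proj₂ edgeˡ))
  ... | inj₂ F⊆B = ℕ.≤-trans (p⊆q⇒∣p∣≤∣q∣ F⊆B) (ℕ.≤-reflexive (proj₂ edgeʳ))

  facetˡ : Facet (Face K) A
  facetˡ = edge-facet {K = K} graph edgeˡ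

  edge≡ : ∀ {E} → Edge K E → E ≡ A ⊎ E ≡ B
  edge≡ (E∈K , ∣E∣≡2) with covers E∈K
  ... | inj₁ E⊆A =
    inj₁ (p⊆q∧∣q∣≤∣p∣⇒p≡q E⊆A (ℕ.≤-reflexive (trans (proj₂ edgeˡ) (sym ∣E∣≡2))))
  ... | inj₂ E⊆B =
    inj₂ (p⊆q∧∣q∣≤∣p∣⇒p≡q E⊆B (ℕ.≤-reflexive (trans (proj₂ edgeʳ) (sym ∣E∣≡2))))

  vertices⊆A∪B : vertices K ⊆ A ∪ B
  vertices⊆A∪B {v} v∈K with covers (vertexFace K v∈K)
  ... | inj₁ v⊆A = x∈p∪q⁺ (inj₁ (v⊆A (x∈⁅x⁆ v)))
  ... | inj₂ v⊆B = x∈p∪q⁺ (inj₂ (v⊆B (x∈⁅x⁆ v)))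

module _ {K : SimplicialComplex n} where

  open IsDisjointEdgePair

  swap-pair : ∀ {A B} → IsDisjointEdgePair K A B → IsDisjointEdgePair K B A
  swap-pair P = record
    { edgeˡ    = edgeʳ P
    ; edgeʳ    = edgeˡ P
    ; disjoint = λ x∈B x∈A → disjoint P x∈A x∈B
    ; covers   = Sum.swap ∘ covers P
    }

  module _ {t} {F : Fin t → Subset n} (F-shelling : IsShelling K F) where

    open IsShelling F-shelling

    -- At the step of `B` every earlier facet lies in `A`, for one inside `B` would be `B` itself.
    -- So the intersection with `B` has only the empty face, of dimension -1, whereas a shelling
    -- asks for dimension 0.
    no-earlier : ∀ {A B i j} → IsDisjointEdgePair K A B → F i ≡ A → F j ≡ B → ¬ i < j
    no-earlier {i = i} {j} P refl refl i<j = dim⊥≢ (shelling j (ℕ.≤-<-trans z≤n i<j) ⊥-facet)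
      where
      dim⊥≢ : dim (⊥ {n}) ≢ dim (F j) ℤ.- 1ℤ
      dim⊥≢ eq rewrite ∣⊥∣≡0 n | proj₂ (edgeʳ P) with () ← eq

      ⊥-facet : Facet (λ G → earlierSimplices F j G × G ⊆ F j) ⊥
      ⊥-facet = (((i , i<j) , ⊆-min _) , ⊆-min _) , λ {G} → maximal {G}
        where
        maximal : ∀ {G} → earlierSimplices F j G × G ⊆ F j → ⊥ ⊆ G → ⊥ ≡ G
        maximal (((l , l<j) , G⊆Fl) , G⊆Fj) _ with Equivalence.from (facets (F l)) (l , refl)
        ... | Fl∈K , Fl-maximal with covers P Fl∈K
        ...   | inj₂ Fl⊆Fj =
          contradiction (distinct (Fl-maximal (proj₁ (edgeʳ P)) Fl⊆Fj)) (Fin.<⇒≢ l<j)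
        ...   | inj₁ Fl⊆Fi =
          sym (Empty-unique λ (_ , x∈G) → disjoint P (Fl⊆Fi (G⊆Fl x∈G)) (G⊆Fj x∈G))

  -- Both edges are facets, so a shelling lists both; whichever comes second contradicts
  -- `no-earlier`.
  pair⇒nonshellable : ∀ {A B} → IsDisjointEdgePair K A B → ¬ Shellable K
  pair⇒nonshellable {A} {B} P (_ , F , F-shelling)
    with i , Fi≡A ← Equivalence.to (IsShelling.facets F-shelling A) (facetˡ P)
       | j , Fj≡B ← Equivalence.to (IsShelling.facets F-shelling B) (facetˡ (swap-pair P))
    with Fin.<-cmp i j
  ... | tri< i<j _ _  = no-earlier F-shelling P Fi≡A Fj≡B i<j
  ... | tri> _ _ j<i  = no-earlier F-shelling (swap-pair P) Fj≡B Fi≡A j<i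
  -- A shared index would make `A` and `B` equal, impossible for disjoint nonempty sets.
  ... | tri≈ _ refl _ with x , x∈A ← nonemptyˡ P =
    disjoint P x∈A (subst (x ∈_) (trans (sym Fi≡A) Fj≡B) x∈A)

  -- A proper induced subcomplex misses a vertex of `A` or of `B`, hence has at most one edge, and
  -- an edge is linked to itself.
  pair⇒obstruction : ∀ {A B} → IsDisjointEdgePair K A B → IsObstruction K
  pair⇒obstruction {A} {B} P = pair⇒nonshellable P , λ U U⊂V →
    linked⇒shellable {K = induced K U (proj₁ U⊂V)} (graph P ∘ proj₁) (link U U⊂V)
    where
    link : ∀ U (U⊂V : U ⊂ vertices K) → let L = induced K U (proj₁ U⊂V) in
           ∀ {E F} → Edge L E → Edge L F → Linked L E F
    link U (_ , z , z∈V , z∉U) {E} {F} E-edge@((E∈K , E⊆U) , ∣E∣≡2) F-edge@((F∈K , F⊆U) , ∣F∣≡2)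
      with edge≡ P (E∈K , ∣E∣≡2) | edge≡ P (F∈K , ∣F∣≡2)
    ... | inj₁ refl | inj₁ refl = E , E-edge , meets , meets
      where meets = proj₁ (nonemptyˡ P) , x∈p∩q⁺ (proj₂ (nonemptyˡ P) , proj₂ (nonemptyˡ P))
    ... | inj₂ refl | inj₂ refl = E , E-edge , meets , meets
      where
      Q = swap-pair P
      meets = proj₁ (nonemptyˡ Q) , x∈p∩q⁺ (proj₂ (nonemptyˡ Q) , proj₂ (nonemptyˡ Q))
    -- Both edges inside `U` would put all of `A ∪ B` there, including the missing vertex `z`.
    ... | inj₁ refl | inj₂ refl = contradiction (∪⊆ E⊆U F⊆U (vertices⊆A∪B P z∈V)) z∉U
    ... | inj₂ refl | inj₁ refl = contradiction (∪⊆ F⊆U E⊆U (vertices⊆A∪B P z∈V)) z∉U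

-- From an obstruction to a pair of disjoint edges

-- If `E` and `F` met, `E` itself would link them. A face inside neither has a vertex in `F` outside
-- `E` and one in `E` outside `F`; having at most two elements, it would be a linking edge.
unlinked⇒pair : ∀ {K : SimplicialComplex n} {E F} → Graph K → Edge K E → Edge K F →
                ¬ Linked K E F → vertices K ⊆ E ∪ F → IsDisjointEdgePair K E F
unlinked⇒pair {K = K} {E} {F} graph E-edge F-edge unlinked V⊆E∪F = record
  { edgeˡ    = E-edge
  ; edgeʳ    = F-edge
  ; disjoint = λ x∈E x∈F →
      unlinked (E , E-edge , (_ , x∈p∩q⁺ (x∈E , x∈E)) , (_ , x∈p∩q⁺ (x∈E , x∈F)))
  ; covers   = covers
  }
  where
  covers : ∀ {G} → Face K G → G ⊆ E ⊎ G ⊆ F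
  covers {G} G∈K with G ⊆? E | G ⊆? F
  ... | yes G⊆E | _       = inj₁ G⊆E
  ... | no _    | yes G⊆F = inj₂ G⊆F
  ... | no G⊈E  | no G⊈F
    with x , x∈G , x∉E ← p⊈q⇒∃∈∉ {p = G} G⊈E | y , y∈G , y∉F ← p⊈q⇒∃∈∉ {p = G} G⊈F
    with x∈p∪q⁻ E F (V⊆E∪F (face⊆ K G∈K x∈G)) | x∈p∪q⁻ E F (V⊆E∪F (face⊆ K G∈K y∈G))
  ... | inj₁ x∈E | _        = contradiction x∈E x∉E
  ... | inj₂ _   | inj₂ y∈F = contradiction y∈F y∉F
  ... | inj₂ x∈F | inj₁ y∈E = contradiction
    (G , (G∈K , ℕ.≤-antisym (graph G∈K) (x∈p∧y∈p∧x≢y⇒2≤∣p∣ x∈G y∈G λ { refl → y∉F x∈F }))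
    , (y , x∈p∩q⁺ (y∈E , y∈G)) , (x , x∈p∩q⁺ (x∈G , x∈F)))
    unlinked

-- Being an edge and being linked are decidable, so a finite search turns nonshellability into
-- explicit unlinked edges.
obstruction⇒pair : (K : SimplicialComplex n) → Graph K → IsObstruction K →
                   ∃₂ λ A B → IsDisjointEdgePair K A B
obstruction⇒pair K graph (nonshellable , proper)
  with anySubset? (λ E → anySubset? λ F → edge? K E ×-dec edge? K F ×-dec ¬? (linked? K E F))
... | no none = contradiction
  (linked⇒shellable {K = K} graph λ {E} {F} E-edge F-edge →
    decidable-stable (linked? K E F) λ unlinked → none (E , F , E-edge , F-edge , unlinked))
  nonshellable
... | yes (E , F , E-edge@(E∈K , ∣E∣≡2) , F-edge@(F∈K , ∣F∣≡2) , unlinked)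
  with vertices K ⊆? (E ∪ F)
... | yes V⊆E∪F = E , F , unlinked⇒pair graph E-edge F-edge unlinked V⊆E∪F
... | no  V⊈E∪F = contradiction (proper (E ∪ F) E∪F⊂V) (pair⇒nonshellable
  -- A linking edge of the induced subcomplex would also link in `K`, so the edges stay unlinked.
  -- Its vertex set is `E ∪ F` by construction, hence the final `id`.
  (unlinked⇒pair {K = induced K (E ∪ F) (proj₁ E∪F⊂V)} (graph ∘ proj₁)
    ((E∈K , p⊆p∪q F) , ∣E∣≡2) ((F∈K , q⊆p∪q E F) , ∣F∣≡2)
    (λ { (G , ((G∈K , _) , ∣G∣≡2) , E∩G , G∩F) → unlinked (G , (G∈K , ∣G∣≡2) , E∩G , G∩F) })
    id))
  where
  E∪F⊂V : E ∪ F ⊂ vertices K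
  E∪F⊂V = ∪⊆ (face⊆ K E∈K) (face⊆ K F∈K) , p⊈q⇒∃∈∉ V⊈E∪F

-- Isomorphism with the standard model

twoDisjointEdges-pair : IsDisjointEdgePair twoDisjointEdges (⁅ 0F ⁆ ∪ ⁅ 1F ⁆) (⁅ 2F ⁆ ∪ ⁅ 3F ⁆)
twoDisjointEdges-pair = record
  { edgeˡ    = inj₁ ⊆-refl , refl
  ; edgeʳ    = inj₂ ⊆-refl , refl
  ; disjoint = λ { here (); (there here) (there ()); (there (there (there (there ())))) }
  ; covers   = id
  }

-- Faces on both sides are given by containment in one of two sets, so comparing faces reduces to
-- matching these sets vertex by vertex.
IsImage-⊆ : ∀ {K : SimplicialComplex m} {L : SimplicialComplex n} {f F G S T} →
            (∀ x → proj₁ x ∈ S ⇔ proj₁ (f x) ∈ T) → F ⊆ vertices K → IsImage K L f F G →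
            F ⊆ S ⇔ G ⊆ T
IsImage-⊆ {f = f} {F} {G} {S} {T} S⇔T F⊆V image = mk⇔ to from
  where
  to : F ⊆ S → G ⊆ T
  to F⊆S {y} y∈G with x , x∈F , refl ← Equivalence.to (image y) y∈G =
    Equivalence.to (S⇔T x) (F⊆S x∈F)

  from : G ⊆ T → F ⊆ S
  -- An element of `F` has an image only as a vertex of `K`; `F⊆V` makes it one.
  from G⊆T x∈F = Equivalence.from (S⇔T x) (G⊆T (Equivalence.from (image _) (x , x∈F , refl)))
    where x = _ , F⊆V x∈F

-- With `A` split into `a`, `b` and `B` into `c`, `d`, the position in `labels` serves as the vertex
-- of the model.
pair⇒≅ : ∀ {K : SimplicialComplex n} {A B} → IsDisjointEdgePair K A B → K ≅ twoDisjointEdges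
pair⇒≅ {n} {K} {A} {B} P
  with a , b , a≢b , refl ← ∣p∣≡2⇒p≡⁅x⁆∪⁅y⁆ A (proj₂ (IsDisjointEdgePair.edgeˡ P))
     | c , d , c≢d , refl ← ∣p∣≡2⇒p≡⁅x⁆∪⁅y⁆ B (proj₂ (IsDisjointEdgePair.edgeʳ P)) =
  record { bijection = bijection ; faces = faces }
  where
  open IsDisjointEdgePair P

  ab cd : Subset 4
  ab = ⁅ 0F ⁆ ∪ ⁅ 1F ⁆
  cd = ⁅ 2F ⁆ ∪ ⁅ 3F ⁆

  a∈A : a ∈ A
  a∈A = x∈p∪q⁺ (inj₁ (x∈⁅x⁆ a))

  b∈A : b ∈ A
  b∈A = x∈p∪q⁺ (inj₂ (x∈⁅x⁆ b))

  c∈B : c ∈ B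
  c∈B = x∈p∪q⁺ (inj₁ (x∈⁅x⁆ c))

  d∈B : d ∈ B
  d∈B = x∈p∪q⁺ (inj₂ (x∈⁅x⁆ d))

  A≢B : ∀ {x y} → x ∈ A → y ∈ B → x ≢ y
  A≢B x∈A y∈B refl = disjoint x∈A y∈B

  labels : List (Fin n)
  labels = a ∷ b ∷ c ∷ d ∷ []

  labels-unique : Unique labels
  labels-unique =
    (a≢b All.∷ A≢B a∈A c∈B All.∷ A≢B a∈A d∈B All.∷ All.[])
    ∷ (A≢B b∈A c∈B All.∷ A≢B b∈A d∈B All.∷ All.[])
    ∷ (c≢d All.∷ All.[])
    ∷ All.[]
    ∷ []

  label∈A : ∀ i → lookup labels i ∈ A ⇔ i ∈ ab
  label∈A 0F = mk⇔ (λ _ → here) (λ _ → a∈A)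
  label∈A 1F = mk⇔ (λ _ → there here) (λ _ → b∈A)
  label∈A 2F = mk⇔ (λ c∈A → contradiction c∈B (disjoint c∈A)) (λ { (there (there ())) })
  label∈A 3F = mk⇔ (λ d∈A → contradiction d∈B (disjoint d∈A)) (λ { (there (there (there ()))) })

  label∈B : ∀ i → lookup labels i ∈ B ⇔ i ∈ cd
  label∈B 0F = mk⇔ (λ a∈B → contradiction a∈B (disjoint a∈A)) (λ ())
  label∈B 1F = mk⇔ (λ b∈B → contradiction b∈B (disjoint b∈A)) (λ { (there ()) })
  label∈B 2F = mk⇔ (λ _ → there (there here)) (λ _ → c∈B)
  label∈B 3F = mk⇔ (λ _ → there (there (there here))) (λ _ → d∈B)

  label∈K : ∀ i → lookup labels i ∈ vertices K
  label∈K 0F = face⊆ K (proj₁ edgeˡ) a∈A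
  label∈K 1F = face⊆ K (proj₁ edgeˡ) b∈A
  label∈K 2F = face⊆ K (proj₁ edgeʳ) c∈B
  label∈K 3F = face⊆ K (proj₁ edgeʳ) d∈B

  label-surjective : ∀ {v} → v ∈ vertices K → ∃ λ i → lookup labels i ≡ v
  label-surjective v∈K with x∈p∪q⁻ A B (vertices⊆A∪B v∈K)
  ... | inj₁ v∈A with x∈p∪q⁻ ⁅ a ⁆ ⁅ b ⁆ v∈A
  ...   | inj₁ v∈⁅a⁆ = 0F , sym (x∈⁅y⁆⇒x≡y a v∈⁅a⁆)
  ...   | inj₂ v∈⁅b⁆ = 1F , sym (x∈⁅y⁆⇒x≡y b v∈⁅b⁆)
  label-surjective v∈K | inj₂ v∈B with x∈p∪q⁻ ⁅ c ⁆ ⁅ d ⁆ v∈B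
  ...   | inj₁ v∈⁅c⁆ = 2F , sym (x∈⁅y⁆⇒x≡y c v∈⁅c⁆)
  ...   | inj₂ v∈⁅d⁆ = 3F , sym (x∈⁅y⁆⇒x≡y d v∈⁅d⁆)

  -- A vertex carries a proof of membership, and such proofs are unique.
  vertex-≡ : ∀ {m} {L : SimplicialComplex m} {v w : Vertex L} → proj₁ v ≡ proj₁ w → v ≡ w
  vertex-≡ {v = v , v∈L} {.v , v∈L′} refl = cong (v ,_) ([]=-irrelevant v∈L v∈L′)

  vertex : Vertex twoDisjointEdges → Vertex K
  vertex (i , _) = lookup labels i , label∈K i

  bijection : Vertex K ↔ Vertex twoDisjointEdges
  -- The labelling runs from the model to `K`, so it is inverted at the end.
  bijection = ↔-sym (⤖⇒↔ (mk⤖ {to = vertex}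
    ( (λ eq → vertex-≡ {L = twoDisjointEdges} (lookup-injective labels-unique (cong proj₁ eq)))
    , λ (v , v∈K) → let i , eq = label-surjective v∈K in
        (i , ∈⊤) , λ { refl → vertex-≡ {L = K} eq })))

  transport : ∀ {S T} → (∀ i → lookup labels i ∈ S ⇔ i ∈ T) →
              ∀ x → proj₁ x ∈ S ⇔ proj₁ (Inverse.to bijection x) ∈ T
  transport {S} {T} S⇔T x =
    -- The hypothesis speaks of labels, and `x` is the label of its own image.
    subst (λ v → proj₁ v ∈ S ⇔ proj₁ (Inverse.to bijection x) ∈ T)
      (Inverse.strictlyInverseʳ bijection x) (S⇔T _)

  faces : ∀ {F G} → F ⊆ vertices K →
          IsImage K twoDisjointEdges (Inverse.to bijection) F G →
          Face K F ⇔ Face twoDisjointEdges G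
  faces {F} {G} F⊆V image = mk⇔ to from
    where
    F⊆A⇔G⊆ab =
      IsImage-⊆ {K = K} {twoDisjointEdges} {Inverse.to bijection} (transport label∈A) F⊆V image
    F⊆B⇔G⊆cd =
      IsImage-⊆ {K = K} {twoDisjointEdges} {Inverse.to bijection} (transport label∈B) F⊆V image

    to : Face K F → Face twoDisjointEdges G
    to F∈K with covers F∈K
    ... | inj₁ F⊆A = inj₁ (Equivalence.to F⊆A⇔G⊆ab F⊆A)
    ... | inj₂ F⊆B = inj₂ (Equivalence.to F⊆B⇔G⊆cd F⊆B)

    from : Face twoDisjointEdges G → Face K F
    from (inj₁ G⊆ab) = downClosed K (Equivalence.from F⊆A⇔G⊆ab G⊆ab) (proj₁ edgeˡ)
    from (inj₂ G⊆cd) = downClosed K (Equivalence.from F⊆B⇔G⊆cd G⊆cd) (proj₁ edgeʳ)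

proposition2 : (IsObstruction twoDisjointEdges × HasDimension twoDisjointEdges 1ℤ)
    × (∀ (n : ℕ) (K : SimplicialComplex n) →
    IsObstruction K → HasDimension K 1ℤ → K ≅ twoDisjointEdges)
proposition2 =
  ( pair⇒obstruction twoDisjointEdges-pair
  , (_ , edgeˡ .proj₁ , refl)
  , λ {F} F∈L → ∣F∣≤2⇒dim≤1 F (graph F∈L))
  , λ n K obstruction (_ , dim≤1) →
      let _ , _ , pair = obstruction⇒pair K (λ {F} F∈K → dim≤1⇒∣F∣≤2 F (dim≤1 F∈K)) obstruction
      in pair⇒≅ pair
  where open IsDisjointEdgePair twoDisjointEdges-pair
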